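{- Let $q$ be a positive integer. There exists an infinite family of (pairwise non-isomorphic) trees $T$ with $\mu(T)=2q+1$ that satisfy $$a(T)-\alpha(T)= \frac{\mu(T)}{2}-\frac12 .$$
   Context: All graphs are finite, undirected, without loops or multiple edges. For a graph $G$, $m(G)$ is its number of edges, $\alpha(G)$ is its independence number, and $\mu(G)$ is its matching number (maximum size of a set of edges no two of which share a vertex). If $d_1\le d_2\le\cdots\le d_n$ is the degree sequence of $G$, the annihilation number $a(G)$ is the largest integer $k\in\{0,\dots,n\}$ such that $\sum_{i=1}^k d_i\le m(G)$. -}

module Defs where

open import Data.Bool.Base using (if_then_else_)
open import Data.Fin.Base using (Fin)
open import Data.Fin.Properties using (all?; any?; _<?_)
  renaming (_≟_ to _≟F_)
open import Data.Fin.Subset using (Subset; _∈_; ∣_∣)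
open import Data.Fin.Subset.Properties using (_∈?_; anySubset?)
open import Data.List.Base
  using (List; _∷_; _∷ʳ_; allFin; cartesianProduct; filter; length; lookup; map; take)
open import Data.List.Relation.Unary.Linked using (Linked)
open import Data.List.Relation.Unary.Unique.Propositional using (Unique)
open import Data.List.Sort using (sort)
open import Data.Nat.Base using (ℕ; zero; suc; _≤_)
open import Data.Nat.ListAction using (sum)
open import Data.Nat.Properties using (_≟_; _≤?_; ≤-decTotalOrder)
open import Data.Product.Base using (∃; _×_; _,_; proj₁; proj₂)
open import Data.Sum.Base using (_⊎_)
open import Function.Bundles using (_↔_; _⇔_; Inverse)
open import Level using (0ℓ)
open import Relation.Binary.Core using (Rel)
import Relation.Binary.Definitions as B
open import Relation.Binary.Construct.Closure.ReflexiveTransitive using (Star)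
open import Relation.Binary.PropositionalEquality.Core using (_≡_; _≢_)
open import Relation.Nullary.Decidable using (does; ¬?; _×-dec_; _⊎-dec_; _→-dec_)
open import Relation.Nullary.Negation using (¬_)
import Relation.Unary as U

record Graph : Set₁ where
  infix 4 _~_ _~?_
  field
    order    : ℕ
    _~_      : Rel (Fin order) 0ℓ
    _~?_     : B.Decidable _~_
    ~-sym    : B.Symmetric _~_
    ~-irrefl : B.Irreflexive _≡_ _~_

  Vertex : Set
  Vertex = Fin order

infix 4 _≅_

record _≅_ (G H : Graph) : Set where
  private
    module G = Graph G
    module H = Graph H
  field
    bijection : G.Vertex ↔ H.Vertex
    adjacency : ∀ u v → (u G.~ v) ⇔ (Inverse.to bijection u H.~ Inverse.to bijection v)

-- The largest k ≤ n satisfying P. The value 0 in the base case is a default,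
-- but every use below has P 0.
largest : {P : ℕ → Set} → U.Decidable P → ℕ → ℕ
largest P? zero    = zero
largest P? (suc n) = if does (P? (suc n)) then suc n else largest P? n

module _ (G : Graph) where
  open Graph G

  -- Each undirected edge {u , v} is listed exactly once, with u < v.
  edges : List (Vertex × Vertex)
  edges = filter (λ (u , v) → (u <? v) ×-dec (u ~? v))
                 (cartesianProduct (allFin order) (allFin order))

  m : ℕ
  m = length edges

  degree : Vertex → ℕ
  degree v = length (filter (v ~?_) (allFin order))

  degreeSequence : List ℕ
  degreeSequence = sort ≤-decTotalOrder (map degree (allFin order))

  annihilationNumber : ℕ
  annihilationNumber = largest (λ k → sum (take k degreeSequence) ≤? m) order

  Independent : Subset order → Set
  Independent S = ∀ u v → u ∈ S → v ∈ S → ¬ (u ~ v)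

  independent? : U.Decidable Independent
  independent? S = all? λ u → all? λ v →
    (u ∈? S) →-dec ((v ∈? S) →-dec ¬? (u ~? v))

  independenceNumber : ℕ
  independenceNumber =
    largest (λ k → anySubset? (λ S → independent? S ×-dec (∣ S ∣ ≟ k))) order

  -- Edges are referred to by their position in the list of edges, so that a
  -- set of edges is a Subset m.
  Incident : Vertex → Fin m → Set
  Incident v e = v ≡ proj₁ (lookup edges e) ⊎ v ≡ proj₂ (lookup edges e)

  incident? : B.Decidable Incident
  incident? v e = (v ≟F proj₁ (lookup edges e)) ⊎-dec (v ≟F proj₂ (lookup edges e))

  Matching : Subset m → Set
  Matching M = ∀ e f → e ∈ M → f ∈ M → e ≢ f → ¬ ∃ λ v → Incident v e × Incident v f

  matching? : U.Decidable Matching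
  matching? M = all? λ e → all? λ f →
    (e ∈? M) →-dec ((f ∈? M) →-dec (¬? (e ≟F f) →-dec
      ¬? (any? λ v → incident? v e ×-dec incident? v f)))

  matchingNumber : ℕ
  matchingNumber =
    largest (λ k → anySubset? (λ M → matching? M ×-dec (∣ M ∣ ≟ k))) m

  Connected : Set
  Connected = ∀ u v → Star _~_ u v

  -- v ∷ vs lists the distinct vertices of a cycle of length at least 3.
  IsCycle : Vertex → List Vertex → Set
  IsCycle v vs = 2 ≤ length vs × Unique (v ∷ vs) × Linked _~_ (v ∷ (vs ∷ʳ v))

  Acyclic : Set
  Acyclic = ∀ v vs → ¬ IsCycle v vs

  record IsTree : Set where
    field
      nonempty  : Vertex
      connected : Connected
      acyclic   : Acyclic

{-# OPTIONS --safe #-}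
module Submission where

-- T i is the spider with 2q legs of length two and i + 1 further leaves at its
-- centre. With t = i + 1, it has 2q + t leaves, which form a maximum independent
-- set, and pairing the centre and every knee with a leaf gives μ = 2q + 1. The
-- degrees are 1 (2q + t times), 2 (2q times) and 2q + t, and m = 4q + t, so the
-- sum reaches m exactly at all leaves and q knees: a = 3q + t = α + q.

open import Defs
open import Data.Bool.Base using (true)
open import Data.Empty using (⊥)
open import Data.Fin.Base as Fin using (Fin; zero; suc; toℕ; _<_; splitAt; _↑ˡ_; _↑ʳ_)
open import Data.Fin.Induction using (<-wellFounded)
open import Data.Fin.Permutation using (↔⇒≡)
open import Data.Fin.Properties as Fin
  using (any?; suc-injective; injective⇒≤; splitAt-↑ˡ; splitAt-↑ʳ; join-splitAt)
open import Data.Fin.Subset using (Subset; ∣_∣; inside; outside) renaming (_∈_ to _∈ₛ_)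
open import Data.Integer.Base as ℤ using (+_)
import Data.Integer.Solver as ℤ-Solver
open import Data.List.Base
  using (List; []; _∷_; [_]; _++_; _∷ʳ_; map; length; lookup; take; replicate;
         tabulate; allFin; cartesianProduct)
open import Data.List.Membership.Propositional using (_∈_)
open import Data.List.Membership.Propositional.Properties
  using (∈-filter⁺; ∈-filter⁻; ∈-cartesianProduct⁺; ∈-allFin; ∈-map⁺; ∈-map⁻; ∈-lookup)
open import Data.List.Membership.Propositional.Properties.WithK using (unique∧set⇒bag)
open import Data.List.Properties
  using (length-map; length-tabulate; length-replicate; length-++; map-tabulate; ++-assoc)
open import Data.List.Relation.Binary.BagAndSetEquality using (∼bag⇒↭)
open import Data.List.Relation.Binary.Permutation.Propositional
  using (_↭_; ↭-trans; ↭⇒↭ₛ; module PermutationReasoning)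
open import Data.List.Relation.Binary.Permutation.Propositional.Properties
  using (↭-length; ++-comm; ++⁺ʳ; ∷↭∷ʳ)
open import Data.List.Relation.Binary.Pointwise using (Pointwise-≡⇒≡)
open import Data.List.Relation.Unary.All as All using (All; []; _∷_)
import Data.List.Relation.Unary.All.Properties as All
open import Data.List.Relation.Unary.AllPairs using (AllPairs; []; _∷_)
open import Data.List.Relation.Unary.Any as Any using (here; there)
open import Data.List.Relation.Unary.Any.Properties using (lookup-index)
open import Data.List.Relation.Unary.Linked using (Linked; _∷_; [-])
open import Data.List.Relation.Unary.Linked.Properties using (AllPairs⇒Linked)
open import Data.List.Relation.Unary.Sorted.TotalOrder.Properties using (↗↭↗⇒≋)
open import Data.List.Relation.Unary.Unique.Propositional using (Unique)
import Data.List.Relation.Unary.Unique.Propositional.Properties as Unique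
open import Data.List.Sort using (sort; sort-↭; sort-↗)
open import Data.Nat.Base as ℕ using (ℕ; zero; suc; _≤_; _+_; _*_; z≤n; s≤s)
open import Data.Nat.ListAction using (sum)
open import Data.Nat.ListAction.Properties using (sum-++)
open import Data.Nat.Properties as ℕ using (≤-decTotalOrder; ≤-totalOrder)
open import Data.Nat.Solver using (module +-*-Solver)
open import Data.Product.Base using (Σ-syntax; ∃; ∃-syntax; _×_; _,_; proj₁; proj₂)
open import Data.Rational.Base as ℚ using (_/_; _-_; ½)
import Data.Rational.Properties as ℚ
import Data.Rational.Unnormalised.Base as ℚᵘ
import Data.Rational.Unnormalised.Properties as ℚᵘ
open import Data.Sum.Base using (_⊎_; inj₁; inj₂; [_,_]′; swap)
open import Data.Vec.Base as Vec using ([]; _∷_)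
open import Data.Vec.Properties using (lookup∘tabulate; lookup⇒[]=; []=⇒lookup)
open import Function.Base using (_∘_; const; id)
open import Function.Bundles using (_⇔_; mk⇔; Equivalence)
open import Function.Definitions using (Injective)
open import Induction.WellFounded using (Acc; acc)
open import Relation.Binary.Construct.Closure.ReflexiveTransitive as Star using (Star; ε; _◅_; _◅◅_)
open import Relation.Binary.Definitions using (tri<; tri≈; tri>)
open import Relation.Binary.PropositionalEquality
  using (_≡_; _≢_; refl; sym; trans; cong; cong₂; subst; subst₂; module ≡-Reasoning)
open import Relation.Nullary.Decidable using (Dec; yes; no; does; _×-dec_; _⊎-dec_; dec-true)
open import Relation.Nullary.Negation using (¬_; contradiction)
import Relation.Unary as U

private variable
  A : Set
  n K : ℕ

-- Bounded maxima and cardinalities of subsets.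

-- The search runs downwards from `n`: maximality of `k` forbids a stop above `k`, and `P k` stops
-- it there.
largest-≡ : {P : ℕ → Set} (P? : U.Decidable P) {k n : ℕ} → k ≤ n → P k →
            (∀ {j} → P j → j ≤ k) → largest P? n ≡ k
largest-≡ P? {n = zero}  z≤n  Pk max = refl
largest-≡ P? {n = suc n} k≤1+n Pk max with P? (suc n)
... | yes P1+n = ℕ.≤-antisym (max P1+n) k≤1+n
... | no ¬P1+n with ℕ.m≤n⇒m<n∨m≡n k≤1+n
...   | inj₁ (s≤s k≤n) = largest-≡ P? k≤n Pk max
...   | inj₂ refl      = contradiction Pk ¬P1+n

-- A bijection of `Fin ∣ S ∣` with `S`; it reduces bounds on `∣ S ∣` to the pigeonhole principle for
-- `Fin`.
record Enumeration (S : Subset n) : Set where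
  field
    element    : Fin ∣ S ∣ → Fin n
    injective  : Injective _≡_ _≡_ element
    sound      : ∀ i → element i ∈ₛ S
    complete   : ∀ {x} → x ∈ₛ S → ∃[ i ] element i ≡ x

enumerate : (S : Subset n) → Enumeration S
enumerate []            = record
  { element = λ () ; injective = λ {} ; sound = λ () ; complete = λ () }
enumerate (outside ∷ S) = record
  { element   = suc ∘ element
  ; injective = injective ∘ suc-injective
  ; sound     = Vec.there ∘ sound
  ; complete  = λ { (Vec.there x∈S) → let i , eq = complete x∈S in i , cong suc eq }
  }
  where open Enumeration (enumerate S)
enumerate {n = suc n} (inside ∷ S) = record
  { element   = element′
  ; injective = injective′
  ; sound     = sound′
  ; complete  = λ where
      Vec.here          → zero , refl
      (Vec.there x∈S)   → let i , eq = complete x∈S in suc i , cong suc eq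
  }
  where
  open Enumeration (enumerate S)
  element′ : Fin (suc ∣ S ∣) → Fin (suc n)
  element′ zero    = zero
  element′ (suc i) = suc (element i)
  injective′ : Injective _≡_ _≡_ element′
  injective′ {zero}  {zero}  _  = refl
  injective′ {suc _} {suc _} eq = cong suc (injective (suc-injective eq))
  sound′ : ∀ i → element′ i ∈ₛ (inside ∷ S)
  sound′ zero    = Vec.here
  sound′ (suc i) = Vec.there (sound i)

-- The source of both upper bounds: `f` sends a vertex to its clique, or an edge to a cover vertex
-- on it.
injectiveOn⇒∣S∣≤ : (S : Subset n) (f : Fin n → Fin K) →
  (∀ {x y} → x ∈ₛ S → y ∈ₛ S → f x ≡ f y → x ≡ y) → ∣ S ∣ ≤ K
injectiveOn⇒∣S∣≤ S f inj =
  injective⇒≤ {f = f ∘ element} (injective ∘ inj (sound _) (sound _))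
  where open Enumeration (enumerate S)

image : (Fin K → Fin n) → Subset n
image f = Vec.tabulate λ x → does (any? λ i → f i Fin.≟ x)

∈-image⁺ : (f : Fin K → Fin n) (i : Fin K) → f i ∈ₛ image f
∈-image⁺ f i = lookup⇒[]= (f i) _
  (trans (lookup∘tabulate _ (f i)) (dec-true (any? λ j → f j Fin.≟ f i) (i , refl)))

∈-image⁻ : (f : Fin K → Fin n) {x : Fin n} → x ∈ₛ image f → ∃[ i ] f i ≡ x
∈-image⁻ f {x} x∈im = unfold (any? λ i → f i Fin.≟ x)
  (trans (sym (lookup∘tabulate (λ x → does (any? λ i → f i Fin.≟ x)) x)) ([]=⇒lookup x∈im))
  where
  unfold : (d : Dec (∃[ i ] f i ≡ x)) → does d ≡ true → ∃[ i ] f i ≡ x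
  unfold (yes p) _ = p

-- The source of both lower bounds. Choosing preimages is injective in one direction, and locating
-- the values of `f` in the enumeration is injective in the other.
∣image∣ : (f : Fin K → Fin n) → Injective _≡_ _≡_ f → ∣ image f ∣ ≡ K
∣image∣ {K} f f-inj = ℕ.≤-antisym
  (injective⇒≤ {f = preimage} λ {i} {j} eq → injective
    (trans (sym (preimage-eq i)) (trans (cong f eq) (preimage-eq j))))
  (injective⇒≤ {f = position} λ {i} {j} eq → f-inj
    (trans (sym (position-eq i)) (trans (cong element eq) (position-eq j))))
  where
  open Enumeration (enumerate (image f))
  preimage : Fin ∣ image f ∣ → Fin K
  preimage i = proj₁ (∈-image⁻ f (sound i))
  preimage-eq : ∀ i → f (preimage i) ≡ element i
  preimage-eq i = proj₂ (∈-image⁻ f (sound i))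
  position : Fin K → Fin ∣ image f ∣
  position i = proj₁ (complete (∈-image⁺ f i))
  position-eq : ∀ i → element (position i) ≡ f i
  position-eq i = proj₂ (complete (∈-image⁺ f i))

-- Lengths, prefix sums and sorting of lists.

-- Degrees and edge counts are lengths of filtered lists; this allows them to be read off from any
-- convenient duplicate-free list with the same members.
unique∧set⇒length≡ : {xs ys : List A} → Unique xs → Unique ys →
  (∀ {x} → x ∈ xs ⇔ x ∈ ys) → length xs ≡ length ys
unique∧set⇒length≡ xs! ys! xs≈ys = ↭-length (∼bag⇒↭ (unique∧set⇒bag xs! ys! xs≈ys))

-- The longer prefix contains all of `xs` and at least the positive entry `suc y` after it.
sum-take-> : ∀ xs y ys j → length xs ℕ.< j → sum xs ℕ.< sum (take j (xs ++ suc y ∷ ys))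
sum-take-> []       y ys (suc j) _         = s≤s z≤n
sum-take-> (x ∷ xs) y ys (suc j) (s≤s l<j) = ℕ.+-monoʳ-< x (sum-take-> xs y ys j l<j)

take-length-++ : (xs ys : List A) → take (length xs) (xs ++ ys) ≡ xs
take-length-++ []       ys = refl
take-length-++ (x ∷ xs) ys = cong (x ∷_) (take-length-++ xs ys)

tabulate-+ : ∀ k {l} (f : Fin (k + l) → A) →
  tabulate f ≡ tabulate (f ∘ (_↑ˡ l)) ++ tabulate (f ∘ (k ↑ʳ_))
tabulate-+ zero    f = refl
tabulate-+ (suc k) f = cong (f zero ∷_) (tabulate-+ k (f ∘ suc))

tabulate-const : {f : Fin n → A} {x : A} → (∀ i → f i ≡ x) → tabulate f ≡ replicate n x
tabulate-const {zero}  eq = refl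
tabulate-const {suc n} eq = cong₂ _∷_ (eq zero) (tabulate-const (eq ∘ suc))

sum-replicate : ∀ n x → sum (replicate n x) ≡ n * x
sum-replicate zero    x = refl
sum-replicate (suc n) x = cong (x ℕ.+_) (sum-replicate n x)

replicate-+ : ∀ m n {x : A} → replicate (m + n) x ≡ replicate m x ++ replicate n x
replicate-+ zero    n = refl
replicate-+ (suc m) n = cong (_ ∷_) (replicate-+ m n)

replicate-++-ascending : ∀ n {x xs} → All (x ≤_) xs → AllPairs _≤_ xs →
                         AllPairs _≤_ (replicate n x ++ xs)
replicate-++-ascending zero    x≤xs xs↗ = xs↗
replicate-++-ascending (suc n) x≤xs xs↗ =
  All.++⁺ (All.replicate⁺ n ℕ.≤-refl) x≤xs ∷ replicate-++-ascending n x≤xs xs↗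

-- An ascending list is determined by its multiset of entries.
sort-≡ : ∀ {xs ys} → xs ↭ ys → AllPairs _≤_ ys → sort ≤-decTotalOrder xs ≡ ys
sort-≡ {xs} xs↭ys ys↗ = Pointwise-≡⇒≡ (↗↭↗⇒≋ ≤-totalOrder
  (sort-↗ ≤-decTotalOrder xs) (AllPairs⇒Linked ys↗)
  (↭⇒↭ₛ (↭-trans (sort-↭ ≤-decTotalOrder xs) xs↭ys)))

-- Certificates for the parameters of an arbitrary graph.

≅⇒order≡ : ∀ {G H} → G ≅ H → Graph.order G ≡ Graph.order H
≅⇒order≡ G≅H = ↔⇒≡ (_≅_.bijection G≅H)

module _ (G : Graph) where
  open Graph G

  degree-≡ : ∀ v {ws} → Unique ws → (∀ {w} → w ∈ ws ⇔ v ~ w) → degree G v ≡ length ws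
  degree-≡ v ws! ws≈N = unique∧set⇒length≡
    (Unique.filter⁺ (v ~?_) (Unique.allFin⁺ order)) ws!
    (mk⇔ (λ w∈ → Equivalence.from ws≈N (proj₂ (∈-filter⁻ (v ~?_) {xs = allFin order} w∈)))
         (λ w∈ → ∈-filter⁺ (v ~?_) (∈-allFin _) (Equivalence.to ws≈N w∈)))

  private
    edge? : U.Decidable λ ((u , v) : Vertex × Vertex) → (u < v) × (u ~ v)
    edge? (u , v) = (u Fin.<? v) ×-dec (u ~? v)

  edges-unique : Unique (edges G)
  edges-unique = Unique.filter⁺ edge?
    (Unique.cartesianProduct⁺ (Unique.allFin⁺ order) (Unique.allFin⁺ order))

  ∈-edges⁺ : ∀ {u v} → u < v → u ~ v → (u , v) ∈ edges G
  ∈-edges⁺ u<v u~v = ∈-filter⁺ edge? (∈-cartesianProduct⁺ (∈-allFin _) (∈-allFin _)) (u<v , u~v)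

  ∈-edges⁻ : ∀ {uv} → uv ∈ edges G → (proj₁ uv < proj₂ uv) × (proj₁ uv ~ proj₂ uv)
  ∈-edges⁻ uv∈ = proj₂ (∈-filter⁻ edge? {xs = cartesianProduct (allFin order) (allFin order)} uv∈)

  -- The prefix `xs` uses up `m G` exactly, and the next degree is positive, so every longer prefix
  -- exceeds `m G`.
  annihilationNumber-≡ : ∀ {xs y ys} → degreeSequence G ≡ xs ++ suc y ∷ ys → sum xs ≡ m G →
                         annihilationNumber G ≡ length xs
  annihilationNumber-≡ {xs} {y} {ys} eq Σxs≡m = largest-≡ _ length-xs≤order
    (ℕ.≤-reflexive (trans (cong (sum ∘ take (length xs)) eq)
      (trans (cong sum (take-length-++ xs (suc y ∷ ys))) Σxs≡m)))
    (λ {j} Σ≤m → ℕ.≮⇒≥ λ l<j → ℕ.<⇒≱ (sum-take-> xs y ys j l<j)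
      (subst₂ _≤_ (cong (sum ∘ take j) eq) (sym Σxs≡m) Σ≤m))
    where
    open ℕ.≤-Reasoning
    length-xs≤order : length xs ≤ order
    length-xs≤order = begin
      length xs                             ≤⟨ ℕ.m≤m+n _ _ ⟩
      length xs + length (suc y ∷ ys)       ≡⟨ length-++ xs ⟨
      length (xs ++ suc y ∷ ys)             ≡⟨ cong length eq ⟨
      length (degreeSequence G)             ≡⟨ ↭-length (sort-↭ ≤-decTotalOrder (map (degree G) (allFin order))) ⟩
      length (map (degree G) (allFin order)) ≡⟨ length-map (degree G) (allFin order) ⟩
      length (allFin order)                 ≡⟨ length-tabulate id ⟩
      order                                 ∎

  -- The cliques {s i, b i} partition the vertices, so that no independent
  -- set has more elements than s.
  independenceNumber-≡ : (s b : Fin K → Vertex) (class : Vertex → Fin K) →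
    (∀ i → class (s i) ≡ i) → (∀ i j → ¬ (s i ~ s j)) → (∀ i → s i ~ b i) →
    (∀ v → v ≡ s (class v) ⊎ v ≡ b (class v)) → independenceNumber G ≡ K
  independenceNumber-≡ {K} s b class class-s s-independent s~b covered = largest-≡ _
    (injective⇒≤ s-injective)
    (image s , independent , ∣image∣ s s-injective)
    λ { (S , S-independent , refl) →
        injectiveOn⇒∣S∣≤ S class λ {u} {v} u∈S v∈S eq →
          same-class (S-independent u v u∈S v∈S) (S-independent v u v∈S u∈S) eq }
    where
    s-injective : Injective _≡_ _≡_ s
    s-injective {i} {j} eq = trans (sym (class-s i)) (trans (cong class eq) (class-s j))
    independent : Independent G (image s)
    independent u v u∈ v∈ with ∈-image⁻ s u∈ | ∈-image⁻ s v∈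
    ... | i , refl | j , refl = s-independent i j
    -- Distinct vertices of one class are its `s` and its `b`, which are adjacent; either of `u` and
    -- `v` may be the `s`.
    same-class : ∀ {u v} → ¬ (u ~ v) → ¬ (v ~ u) → class u ≡ class v → u ≡ v
    same-class {u} {v} u≁v v≁u eq with covered u | covered v
    ... | inj₁ p | inj₁ q = trans p (trans (cong s eq) (sym q))
    ... | inj₂ p | inj₂ q = trans p (trans (cong b eq) (sym q))
    ... | inj₁ p | inj₂ q = contradiction (subst₂ _~_ (sym (trans p (cong s eq))) (sym q) (s~b _)) u≁v
    ... | inj₂ p | inj₁ q = contradiction (subst₂ _~_ (sym q) (sym (trans p (cong b eq))) (s~b _)) v≁u

  -- The edges {c i, d i} form a matching, and the c i a vertex cover, so that
  -- no matching has more edges than c.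
  matchingNumber-≡ : (c d : Fin K → Vertex) (mate : Vertex → Fin K) →
    (∀ i → mate (c i) ≡ i) → (∀ i → mate (d i) ≡ i) →
    (∀ i → c i < d i) → (∀ i → c i ~ d i) →
    (∀ {u v} → u ~ v → (∃[ i ] u ≡ c i) ⊎ (∃[ i ] v ≡ c i)) → matchingNumber G ≡ K
  matchingNumber-≡ {K} c d mate mate-c mate-d c<d c~d cover = largest-≡ _
    (injective⇒≤ e-injective)
    (image e , matching , ∣image∣ e e-injective)
    λ { (M , M-matching , refl) →
        injectiveOn⇒∣S∣≤ M (proj₁ ∘ covered) λ {f} {g} f∈M g∈M eq →
          same-cover f g (M-matching f g f∈M g∈M) eq }
    where
    cd∈edges : ∀ i → (c i , d i) ∈ edges G
    cd∈edges i = ∈-edges⁺ (c<d i) (c~d i)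
    -- Matchings consist of positions in `edges G`. Edges are listed with the smaller end first,
    -- hence the condition `c i < d i`.
    e : Fin K → Fin (m G)
    e i = Any.index (cd∈edges i)
    lookup-e : ∀ i → (c i , d i) ≡ lookup (edges G) (e i)
    lookup-e i = lookup-index (cd∈edges i)
    -- Both ends of `e i` have mate `i`, so edges with different indices share no vertex. This
    -- yields the injectivity of `e` as well as the matching property.
    incident-mate : ∀ i {v} → Incident G v (e i) → mate v ≡ i
    incident-mate i (inj₁ refl) = trans (cong (mate ∘ proj₁) (sym (lookup-e i))) (mate-c i)
    incident-mate i (inj₂ refl) = trans (cong (mate ∘ proj₂) (sym (lookup-e i))) (mate-d i)
    e-injective : Injective _≡_ _≡_ e
    e-injective {i} {j} eq = trans (sym (incident-mate i (inj₁ refl)))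
      (incident-mate j (inj₁ (cong (proj₁ ∘ lookup (edges G)) eq)))
    matching : Matching G (image e)
    matching f g f∈ g∈ f≢g (v , v-f , v-g) with ∈-image⁻ e f∈ | ∈-image⁻ e g∈
    ... | i , refl | j , refl =
      f≢g (cong e (trans (sym (incident-mate i v-f)) (incident-mate j v-g)))
    covered : ∀ f → ∃[ i ] Incident G (c i) f
    covered f with cover (proj₂ (∈-edges⁻ (∈-lookup {xs = edges G} f)))
    ... | inj₁ (i , eq) = i , inj₁ (sym eq)
    ... | inj₂ (i , eq) = i , inj₂ (sym eq)
    same-cover : ∀ f g → (f ≢ g → ¬ ∃ λ v → Incident G v f × Incident G v g) →
                 proj₁ (covered f) ≡ proj₁ (covered g) → f ≡ g
    same-cover f g disjoint eq with f Fin.≟ g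
    ... | yes f≡g = f≡g
    ... | no  f≢g = contradiction
      (_ , proj₂ (covered f) , subst (λ i → Incident G (c i) g) (sym eq) (proj₂ (covered g)))
      (disjoint f≢g)

  -- Acyclicity when every vertex has at most one smaller neighbour.

  module _ (down-unique : ∀ {u v w} → u ~ v → u ~ w → v < u → w < u → v ≡ w) where

    private
      compare : ∀ {u v} → u ~ v → u < v ⊎ v < u
      compare {u} {v} u~v with Fin.<-cmp u v
      ... | tri< u<v _ _ = inj₁ u<v
      ... | tri≈ _ u≡v _ = contradiction u~v (~-irrefl u≡v)
      ... | tri> _ _ v<u = inj₂ v<u

      -- A path never turns from up to down, so it goes down all the way,
      -- unless its last step goes up.
      path-shape : ∀ a b ws z → Linked _~_ (a ∷ b ∷ ws ∷ʳ z) → Unique (a ∷ b ∷ ws) →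
        All (_≢ z) (a ∷ b ∷ ws) →
        (b < a × z < a) ⊎ ((b < a ⊎ a < z) × ∃[ y ] y ∈ b ∷ ws × z ~ y × y < z)
      path-shape a b [] z (a~b ∷ b~z ∷ [-]) _ (a≢z ∷ _) with compare b~z | compare a~b
      -- A turn at `b` from up to down makes `a` and `z` smaller neighbours of `b`, hence equal.
      ... | inj₂ z<b | inj₁ a<b = contradiction (down-unique (~-sym a~b) b~z a<b z<b) a≢z
      ... | inj₂ z<b | inj₂ b<a = inj₁ (b<a , Fin.<-trans z<b b<a)
      ... | inj₁ b<z | inj₁ a<b = inj₂ (inj₂ (Fin.<-trans a<b b<z) , b , here refl , ~-sym b~z , b<z)
      ... | inj₁ b<z | inj₂ b<a = inj₂ (inj₁ b<a , b , here refl , ~-sym b~z , b<z)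
      path-shape a b (c ∷ ws) z (a~b ∷ b~ws) ((_ ∷ a≢c ∷ _) ∷ ws!) (_ ∷ ≢z)
        with path-shape b c ws z b~ws ws! ≢z | compare a~b | b~ws
      ... | inj₁ (c<b , _)        | inj₁ a<b | b~c ∷ _ = contradiction (down-unique (~-sym a~b) b~c a<b c<b) a≢c
      ... | inj₁ (_ , z<b)        | inj₂ b<a | _       = inj₁ (b<a , Fin.<-trans z<b b<a)
      ... | inj₂ (inj₁ c<b , _)   | inj₁ a<b | b~c ∷ _ = contradiction (down-unique (~-sym a~b) b~c a<b c<b) a≢c
      ... | inj₂ (inj₂ b<z , y , y∈ , up) | inj₁ a<b | _ = inj₂ (inj₂ (Fin.<-trans a<b b<z) , y , there y∈ , up)
      ... | inj₂ (_ , y , y∈ , up) | inj₂ b<a | _      = inj₂ (inj₁ b<a , y , there y∈ , up)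

    -- For the cycle opened at `v`, `path-shape` gives either `x` the smaller neighbours `v` and
    -- `y`, or `v` the smaller neighbours `x` and `w`. Both pairs are distinct on a cycle. The one
    -- other case has `x < v` and `v < x`.
    acyclic-by-order : Acyclic G
    acyclic-by-order v (x ∷ [])     (s≤s () , _)
    acyclic-by-order v (x ∷ y ∷ ws) (_ , (v≢ ∷ ws!@(x≢ ∷ _)) , v~x ∷ linked@(x~y ∷ _))
      with path-shape x y ws v linked ws! (All.map (λ v≢w → v≢w ∘ sym) v≢) | compare v~x
    ... | inj₁ (y<x , v<x)    | _        = All.lookup v≢ (there (here refl)) (down-unique (~-sym v~x) x~y v<x y<x)
    ... | inj₂ (inj₁ y<x , _) | inj₁ v<x = All.lookup v≢ (there (here refl)) (down-unique (~-sym v~x) x~y v<x y<x)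
    ... | inj₂ (inj₂ x<v , _) | inj₁ v<x = Fin.<-irrefl refl (Fin.<-trans x<v v<x)
    ... | inj₂ (_ , w , w∈ , v~w , w<v) | inj₂ x<v = All.lookup x≢ w∈ (down-unique v~x v~w x<v w<v)

-- Trees given by a parent function.

module ParentTree {n : ℕ} (parent : Fin n → Fin (suc n)) (parent≤ : ∀ v → toℕ (parent v) ≤ toℕ v) where

  infix 4 _IsParentOf_ _IsParentOf?_

  -- The root is `zero`, and `parent v` belongs to the vertex `suc v`. Through this shift the weak
  -- bound `parent≤` says that parents are strictly smaller than their children.
  _IsParentOf_ : Fin (suc n) → Fin (suc n) → Set
  u IsParentOf zero  = ⊥
  u IsParentOf suc v = u ≡ parent v

  _IsParentOf?_ : ∀ u v → Dec (u IsParentOf v)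
  u IsParentOf? zero  = no λ ()
  u IsParentOf? suc v = u Fin.≟ parent v

  parent⇒< : ∀ {u v} → u IsParentOf v → u < v
  parent⇒< {v = suc v} refl = s≤s (parent≤ v)

  parent-unique : ∀ {u v w} → v IsParentOf u → w IsParentOf u → v ≡ w
  parent-unique {suc u} refl refl = refl

  tree : Graph
  tree = record
    { order    = suc n
    ; _~_      = λ u v → u IsParentOf v ⊎ v IsParentOf u
    ; _~?_     = λ u v → (u IsParentOf? v) ⊎-dec (v IsParentOf? u)
    ; ~-sym    = swap
    ; ~-irrefl = λ { refl → Fin.<-irrefl refl ∘ [ parent⇒< , parent⇒< ]′ }
    }

  open Graph tree using (_~_; ~-sym)

  <∧~⇒parent : ∀ {u v} → u < v → u ~ v → u IsParentOf v
  <∧~⇒parent u<v (inj₁ p) = p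
  <∧~⇒parent u<v (inj₂ p) = contradiction (Fin.<-trans u<v (parent⇒< p)) (Fin.<-irrefl refl)

  to-root : ∀ v → Acc _<_ v → Star _~_ v zero
  to-root zero    _        = ε
  to-root (suc v) (acc rs) = inj₂ refl ◅ to-root (parent v) (rs (s≤s (parent≤ v)))

  isTree : IsTree tree
  isTree = record
    { nonempty  = zero
    ; connected = λ u v → to-root u (<-wellFounded u) ◅◅
                          Star.reverse ~-sym (to-root v (<-wellFounded v))
    -- A smaller neighbour can only be the parent, which is unique.
    ; acyclic   = acyclic-by-order tree λ u~v u~w v<u w<u →
        parent-unique (<∧~⇒parent v<u (~-sym u~v)) (<∧~⇒parent w<u (~-sym u~w))
    }

  -- Each non-root vertex is the larger end of exactly one edge, the one to its parent.
  m-tree : m tree ≡ n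
  m-tree = trans
    (unique∧set⇒length≡ (edges-unique tree)
      (Unique.map⁺ (suc-injective ∘ cong proj₂) (Unique.allFin⁺ n)) (mk⇔ to from))
    (trans (length-map edge (allFin n)) (length-tabulate id))
    where
    edge : Fin n → Fin (suc n) × Fin (suc n)
    edge v = parent v , suc v
    to : ∀ {uv} → uv ∈ edges tree → uv ∈ map edge (allFin n)
    to {u , v} uv∈ with ∈-edges⁻ tree uv∈
    to {u , suc v} uv∈ | u<v , u~v with <∧~⇒parent u<v u~v
    ... | refl = ∈-map⁺ edge (∈-allFin v)
    from : ∀ {uv} → uv ∈ map edge (allFin n) → uv ∈ edges tree
    from uv∈ with ∈-map⁻ edge uv∈
    ... | v , _ , refl = ∈-edges⁺ tree (s≤s (parent≤ v)) (inj₁ refl)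

-- Construction of the spiders.

-- The legs are the paths zero — knee j — foot j; the leaves of the tree are the
-- feet and the suc s pendants, numbered in this order.
module Spider (k s : ℕ) where

  #leaves : ℕ
  #leaves = k + suc s

  NonRoot Vertex : Set
  NonRoot = Fin (k + #leaves)
  Vertex  = Fin (suc (k + #leaves))

  knee : Fin k → Vertex
  knee j = suc (j ↑ˡ #leaves)

  leaf : Fin #leaves → Vertex
  leaf i = suc (k ↑ʳ i)

  foot : Fin k → Vertex
  foot j = leaf (j ↑ˡ suc s)

  pendant : Fin (suc s) → Vertex
  pendant i = leaf (k ↑ʳ i)

  neighbour : Fin #leaves → Vertex
  neighbour i = [ knee , const zero ]′ (splitAt k i)

  neighbour-foot : ∀ j → neighbour (j ↑ˡ suc s) ≡ knee j
  neighbour-foot j = cong [ knee , const zero ]′ (splitAt-↑ˡ k j (suc s))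

  neighbour-pendant : ∀ i → neighbour (k ↑ʳ i) ≡ zero
  neighbour-pendant i = cong [ knee , const zero ]′ (splitAt-↑ʳ k (suc s) i)

  parent : NonRoot → Vertex
  parent v = [ const zero , neighbour ]′ (splitAt k v)

  parent-knee : ∀ j → parent (j ↑ˡ #leaves) ≡ zero
  parent-knee j = cong [ const zero , neighbour ]′ (splitAt-↑ˡ k j #leaves)

  parent-leaf : ∀ i → parent (k ↑ʳ i) ≡ neighbour i
  parent-leaf i = cong [ const zero , neighbour ]′ (splitAt-↑ʳ k #leaves i)

  parent-foot : ∀ j → parent (k ↑ʳ (j ↑ˡ suc s)) ≡ knee j
  parent-foot j = trans (parent-leaf _) (neighbour-foot j)

  parent-pendant : ∀ i → parent (k ↑ʳ (k ↑ʳ i)) ≡ zero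
  parent-pendant i = trans (parent-leaf _) (neighbour-pendant i)

  data View : Vertex → Set where
    rootᵛ    : View zero
    kneeᵛ    : ∀ j → View (knee j)
    footᵛ    : ∀ j → View (foot j)
    pendantᵛ : ∀ i → View (pendant i)

  view-leaf : ∀ i → View (leaf i)
  view-leaf i with splitAt k i | join-splitAt k (suc s) i
  ... | inj₁ j | refl = footᵛ j
  ... | inj₂ p | refl = pendantᵛ p

  view : ∀ v → View v
  view zero    = rootᵛ
  view (suc v) with splitAt k v | join-splitAt k #leaves v
  ... | inj₁ j | refl = kneeᵛ j
  ... | inj₂ i | refl = view-leaf i

  parent≤′ : ∀ {v} → View (suc v) → toℕ (parent v) ≤ toℕ v
  parent≤′ (kneeᵛ j)    rewrite parent-knee j    = z≤n
  parent≤′ (pendantᵛ i) rewrite parent-pendant i = z≤n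
  -- All knees are numbered before all leaves: the knee has number `suc (toℕ j)`, which is at most
  -- `k`.
  parent≤′ (footᵛ j)    rewrite parent-foot j | Fin.toℕ-↑ˡ j #leaves
                             | Fin.toℕ-↑ʳ k (j ↑ˡ suc s) =
    ℕ.≤-trans (Fin.toℕ<n j) (ℕ.m≤m+n k _)

  open ParentTree parent (parent≤′ ∘ view ∘ suc) public
  open Graph tree public using (_~_; ~-sym)

  knee-injective : ∀ {i j} → knee i ≡ knee j → i ≡ j
  knee-injective = Fin.↑ˡ-injective #leaves _ _ ∘ suc-injective

  knee≢leaf : ∀ {j i} → knee j ≢ leaf i
  knee≢leaf {j} {i} eq with trans (sym (splitAt-↑ˡ k j #leaves))
    (trans (cong (splitAt k) (suc-injective eq)) (splitAt-↑ʳ k #leaves i))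
  ... | ()

  leaf≢neighbour : ∀ {i i′} → leaf i ≢ neighbour i′
  leaf≢neighbour {i′ = i′} eq with splitAt k i′
  leaf≢neighbour eq | inj₁ j = knee≢leaf (sym eq)
  leaf≢neighbour () | inj₂ _

  leaf-childless : ∀ {i v} → ¬ leaf i IsParentOf v
  leaf-childless {v = suc v} eq with splitAt k v
  leaf-childless {v = suc v} () | inj₁ j
  leaf-childless {v = suc v} eq | inj₂ i = leaf≢neighbour eq

  root~knee : ∀ j → zero ~ knee j
  root~knee j = inj₁ (sym (parent-knee j))

  knee~foot : ∀ j → knee j ~ foot j
  knee~foot j = inj₁ (sym (parent-foot j))

  root~pendant : ∀ i → zero ~ pendant i
  root~pendant i = inj₁ (sym (parent-pendant i))

  leaf~neighbour : ∀ i → leaf i ~ neighbour i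
  leaf~neighbour i = inj₂ (sym (parent-leaf i))

  -- Independence number and matching number of the spiders.

  -- The clique of each vertex, named by its leaf. A knee joins its foot, the root joins the first
  -- pendant, and every other pendant stays alone.
  leafAt : Vertex → Fin #leaves
  leafAt zero    = k ↑ʳ zero
  leafAt (suc v) = [ _↑ˡ suc s , id ]′ (splitAt k v)

  leafAt-leaf : ∀ i → leafAt (leaf i) ≡ i
  leafAt-leaf i = cong [ _↑ˡ suc s , id ]′ (splitAt-↑ʳ k #leaves i)

  leafAt-knee : ∀ j → leafAt (knee j) ≡ j ↑ˡ suc s
  leafAt-knee j = cong [ _↑ˡ suc s , id ]′ (splitAt-↑ˡ k j #leaves)

  independenceNumber-spider : independenceNumber tree ≡ #leaves
  independenceNumber-spider = independenceNumber-≡ tree leaf neighbour leafAt leafAt-leaf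
    -- An edge between two leaves would make one of them a parent.
    (λ i j → [ leaf-childless , leaf-childless ]′) leaf~neighbour (covered ∘ view)
    where
    covered : ∀ {v} → View v → v ≡ leaf (leafAt v) ⊎ v ≡ neighbour (leafAt v)
    covered rootᵛ        = inj₂ (sym (neighbour-pendant zero))
    covered (kneeᵛ j)    = inj₂ (sym (trans (cong neighbour (leafAt-knee j)) (neighbour-foot j)))
    covered (footᵛ j)    = inj₁ (cong leaf (sym (leafAt-leaf _)))
    covered (pendantᵛ i) = inj₁ (cong leaf (sym (leafAt-leaf _)))

  coverVertex : Fin (suc k) → Vertex
  coverVertex zero    = zero
  coverVertex (suc j) = knee j

  matchedLeaf : Fin (suc k) → Vertex
  matchedLeaf zero    = pendant zero
  matchedLeaf (suc j) = foot j

  -- Index `zero` groups the pendants with the root, and `suc j` stands for leg `j`; the matching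
  -- has one edge in each group.
  leafLeg : Fin #leaves → Fin (suc k)
  leafLeg i = [ suc , const zero ]′ (splitAt k i)

  leg : Vertex → Fin (suc k)
  leg zero    = zero
  leg (suc v) = [ suc , leafLeg ]′ (splitAt k v)

  leg-leaf : ∀ i → leg (leaf i) ≡ leafLeg i
  leg-leaf i = cong [ suc , leafLeg ]′ (splitAt-↑ʳ k #leaves i)

  matchingNumber-spider : matchingNumber tree ≡ suc k
  matchingNumber-spider = matchingNumber-≡ tree coverVertex matchedLeaf leg
    leg-cover leg-matched
    (λ i → parent⇒< (cover-parent i)) (inj₁ ∘ cover-parent) cover
    where
    leg-cover : ∀ i → leg (coverVertex i) ≡ i
    leg-cover zero    = refl
    leg-cover (suc j) = cong [ suc , leafLeg ]′ (splitAt-↑ˡ k j #leaves)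
    leg-matched : ∀ i → leg (matchedLeaf i) ≡ i
    leg-matched zero    = trans (leg-leaf _) (cong [ suc , const zero ]′ (splitAt-↑ʳ k (suc s) zero))
    leg-matched (suc j) = trans (leg-leaf _) (cong [ suc , const zero ]′ (splitAt-↑ˡ k j (suc s)))
    cover-parent : ∀ i → coverVertex i IsParentOf matchedLeaf i
    cover-parent zero    = sym (parent-pendant zero)
    cover-parent (suc j) = sym (parent-foot j)
    -- Every edge contains a parent, and only the root and the knees can be parents; so these form a
    -- vertex cover.
    parent-covers : ∀ {u v} → View u → u IsParentOf v → ∃[ i ] u ≡ coverVertex i
    parent-covers rootᵛ        _ = zero , refl
    parent-covers (kneeᵛ j)    _ = suc j , refl
    parent-covers {v = v} (footᵛ j)    p = contradiction p (leaf-childless {v = v})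
    parent-covers {v = v} (pendantᵛ i) p = contradiction p (leaf-childless {v = v})
    cover : ∀ {u v} → u ~ v → (∃[ i ] u ≡ coverVertex i) ⊎ (∃[ i ] v ≡ coverVertex i)
    cover {u} {v} (inj₁ p) = inj₁ (parent-covers {v = v} (view u) p)
    cover {u} {v} (inj₂ p) = inj₂ (parent-covers {v = u} (view v) p)

  -- Degrees and annihilation number of the spiders.

  degree-leaf : ∀ i → degree tree (leaf i) ≡ 1
  degree-leaf i = degree-≡ tree (leaf i) {ws = [ neighbour i ]} ([] ∷ []) (mk⇔ to from)
    where
    to : ∀ {w} → w ∈ [ neighbour i ] → leaf i ~ w
    to (here refl) = leaf~neighbour i
    from : ∀ {w} → leaf i ~ w → w ∈ [ neighbour i ]
    from {w} (inj₁ p) = contradiction p (leaf-childless {v = w})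
    from     (inj₂ p) = here (trans p (parent-leaf i))

  degree-knee : ∀ j → degree tree (knee j) ≡ 2
  degree-knee j = degree-≡ tree (knee j) {ws = zero ∷ foot j ∷ []}
    (((λ ()) ∷ []) ∷ [] ∷ []) (mk⇔ to (from (view _)))
    where
    to : ∀ {w} → w ∈ zero ∷ foot j ∷ [] → knee j ~ w
    to (here refl)         = ~-sym {zero} {knee j} (root~knee j)
    to (there (here refl)) = knee~foot j
    from : ∀ {w} → View w → knee j ~ w → w ∈ zero ∷ foot j ∷ []
    from v           (inj₂ p) = here (trans p (parent-knee j))
    from (kneeᵛ j′)   (inj₁ p) with () ← trans p (parent-knee j′)
    from (footᵛ j′)   (inj₁ p) with refl ← knee-injective (trans p (parent-foot j′)) = there (here refl)
    from (pendantᵛ i) (inj₁ p) with () ← trans p (parent-pendant i)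

  -- The branches at the root correspond to the leaves: each contains exactly one, recovered by
  -- `leafAt`.
  degree-root : degree tree zero ≡ #leaves
  degree-root = trans
    (degree-≡ tree zero
      (Unique.map⁺ child-injective (Unique.allFin⁺ #leaves)) (mk⇔ to (from (view _))))
    (trans (length-map child (allFin #leaves)) (length-tabulate id))
    where
    child : Fin #leaves → Vertex
    child i = [ knee , pendant ]′ (splitAt k i)
    child-knee : ∀ j → child (j ↑ˡ suc s) ≡ knee j
    child-knee j = cong [ knee , pendant ]′ (splitAt-↑ˡ k j (suc s))
    child-pendant : ∀ i → child (k ↑ʳ i) ≡ pendant i
    child-pendant i = cong [ knee , pendant ]′ (splitAt-↑ʳ k (suc s) i)
    leafAt-child : ∀ i → leafAt (child i) ≡ i
    leafAt-child i with splitAt k i | join-splitAt k (suc s) i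
    ... | inj₁ j | refl = leafAt-knee j
    ... | inj₂ p | refl = leafAt-leaf _
    child-injective : ∀ {i j} → child i ≡ child j → i ≡ j
    child-injective eq = trans (sym (leafAt-child _)) (trans (cong leafAt eq) (leafAt-child _))
    root~child : ∀ i → zero ~ child i
    root~child i with splitAt k i
    ... | inj₁ j = root~knee j
    ... | inj₂ p = root~pendant p
    to : ∀ {w} → w ∈ map child (allFin #leaves) → zero ~ w
    to w∈ with ∈-map⁻ child w∈
    ... | i , _ , refl = root~child i
    from : ∀ {w} → View w → zero ~ w → w ∈ map child (allFin #leaves)
    from rootᵛ        (inj₁ ())
    from rootᵛ        (inj₂ ())
    from (kneeᵛ j)    _ = subst (_∈ _) (child-knee j) (∈-map⁺ child (∈-allFin _))
    from (footᵛ j)    (inj₁ p) with () ← trans p (parent-foot j)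
    from (pendantᵛ i) _ = subst (_∈ _) (child-pendant i) (∈-map⁺ child (∈-allFin _))

  degreeSequence-spider : 1 ≤ k →
    degreeSequence tree ≡ replicate #leaves 1 ++ replicate k 2 ++ [ #leaves ]
  degreeSequence-spider 1≤k = sort-≡ permuted ascending
    where
    open PermutationReasoning
    permuted : map (degree tree) (allFin _) ↭ replicate #leaves 1 ++ replicate k 2 ++ [ #leaves ]
    permuted = begin
      map (degree tree) (allFin _)
        ≡⟨ map-tabulate id (degree tree) ⟩
      degree tree zero ∷ tabulate (degree tree ∘ suc)
        ≡⟨ cong₂ _∷_ degree-root (trans (tabulate-+ k (degree tree ∘ suc))
             (cong₂ _++_ (tabulate-const degree-knee) (tabulate-const degree-leaf))) ⟩
      #leaves ∷ (replicate k 2 ++ replicate #leaves 1)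
        ↭⟨ ∷↭∷ʳ #leaves _ ⟩
      (replicate k 2 ++ replicate #leaves 1) ++ [ #leaves ]
        ↭⟨ ++⁺ʳ [ #leaves ] (++-comm (replicate k 2) (replicate #leaves 1)) ⟩
      (replicate #leaves 1 ++ replicate k 2) ++ [ #leaves ]
        ≡⟨ ++-assoc (replicate #leaves 1) (replicate k 2) [ #leaves ] ⟩
      replicate #leaves 1 ++ replicate k 2 ++ [ #leaves ] ∎
    -- With a foot and a pendant present, the degree of the root is at least that of a knee and may
    -- stand last.
    2≤#leaves : 2 ≤ #leaves
    2≤#leaves = ℕ.+-mono-≤ 1≤k (s≤s z≤n)
    ascending : AllPairs _≤_ (replicate #leaves 1 ++ replicate k 2 ++ [ #leaves ])
    ascending = replicate-++-ascending #leaves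
      (All.++⁺ (All.replicate⁺ k (s≤s z≤n)) (ℕ.≤-trans (s≤s z≤n) 2≤#leaves ∷ []))
      (replicate-++-ascending k (2≤#leaves ∷ []) ([] ∷ []))

annihilationNumber-spider : ∀ q s → 1 ≤ q →
  annihilationNumber (Spider.tree (q + q) s) ≡ (q + q + suc s) + q
-- Matching `q` as a successor exposes the entry after the prefix: the first of the `q` remaining
-- twos.
annihilationNumber-spider q@(suc q-1) s 1≤q = trans
  (annihilationNumber-≡ tree
    {xs = replicate #leaves 1 ++ replicate q 2} {ys = replicate q-1 2 ++ [ #leaves ]} split total)
  (trans (length-++ (replicate #leaves 1))
    (cong₂ _+_ (length-replicate #leaves) (length-replicate q)))
  where
  open Spider (q + q) s
  open ≡-Reasoning
  split : degreeSequence tree ≡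
          (replicate #leaves 1 ++ replicate q 2) ++ replicate q 2 ++ [ #leaves ]
  split = begin
    degreeSequence tree
      ≡⟨ degreeSequence-spider (ℕ.≤-trans 1≤q (ℕ.m≤m+n q q)) ⟩
    replicate #leaves 1 ++ replicate (q + q) 2 ++ [ #leaves ]
      ≡⟨ cong (λ xs → replicate #leaves 1 ++ xs ++ [ #leaves ]) (replicate-+ q q) ⟩
    replicate #leaves 1 ++ (replicate q 2 ++ replicate q 2) ++ [ #leaves ]
      ≡⟨ cong (replicate #leaves 1 ++_) (++-assoc (replicate q 2) (replicate q 2) [ #leaves ]) ⟩
    replicate #leaves 1 ++ replicate q 2 ++ replicate q 2 ++ [ #leaves ]
      ≡⟨ ++-assoc (replicate #leaves 1) (replicate q 2) (replicate q 2 ++ [ #leaves ]) ⟨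
    (replicate #leaves 1 ++ replicate q 2) ++ replicate q 2 ++ [ #leaves ] ∎
  total : sum (replicate #leaves 1 ++ replicate q 2) ≡ m tree
  total = begin
    sum (replicate #leaves 1 ++ replicate q 2)
      ≡⟨ sum-++ (replicate #leaves 1) (replicate q 2) ⟩
    sum (replicate #leaves 1) + sum (replicate q 2)
      ≡⟨ cong₂ _+_ (sum-replicate #leaves 1) (sum-replicate q 2) ⟩
    #leaves * 1 + q * 2
      ≡⟨ solve 2 (λ l q → l :* con 1 :+ q :* con 2 := q :+ q :+ l) refl #leaves q ⟩
    q + q + #leaves
      ≡⟨ m-tree ⟨
    m tree ∎
    where open +-*-Solver

-- Passage from natural numbers to the rational identity.

-- On unnormalised fractions subtraction is plain integer arithmetic, free of the gcds of reduced
-- ones.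
-/-≡ : ∀ i j d e →
  (i / suc d) - (j / suc e) ≡ ℚ.fromℚᵘ (ℚᵘ.mkℚᵘ i d ℚᵘ.- ℚᵘ.mkℚᵘ j e)
-/-≡ i j d e = ℚ.toℚᵘ-injective (begin
  ℚ.toℚᵘ (p - r)                  ≈⟨ ℚ.toℚᵘ-homo-+ p (ℚ.- r) ⟩
  ℚ.toℚᵘ p ℚᵘ.+ ℚ.toℚᵘ (ℚ.- r)    ≈⟨ ℚᵘ.+-congʳ (ℚ.toℚᵘ p) (ℚ.toℚᵘ-homo‿- r) ⟩
  ℚ.toℚᵘ p ℚᵘ.- ℚ.toℚᵘ r          ≈⟨ ℚᵘ.+-cong (ℚ.toℚᵘ-fromℚᵘ (ℚᵘ.mkℚᵘ i d))
                                       (ℚᵘ.-‿cong (ℚ.toℚᵘ-fromℚᵘ (ℚᵘ.mkℚᵘ j e))) ⟩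
  ℚᵘ.mkℚᵘ i d ℚᵘ.- ℚᵘ.mkℚᵘ j e    ≈⟨ ℚ.toℚᵘ-fromℚᵘ (ℚᵘ.mkℚᵘ i d ℚᵘ.- ℚᵘ.mkℚᵘ j e) ⟨
  ℚ.toℚᵘ (ℚ.fromℚᵘ (ℚᵘ.mkℚᵘ i d ℚᵘ.- ℚᵘ.mkℚᵘ j e)) ∎)
  where
  open ℚᵘ.≃-Reasoning
  p = i / suc d
  r = j / suc e

-- Both sides equal `q`.
difference≡half-minus-½ : ∀ {a c} b q → a ≡ b + q → c ≡ 2 * q + 1 →
  (+ a / 1) - (+ b / 1) ≡ (+ c / 2) - ½
difference≡half-minus-½ b q refl refl = begin
  (+ (b + q) / 1) - (+ b / 1)      ≡⟨ -/-≡ (+ (b + q)) (+ b) 0 0 ⟩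
  ℚ.fromℚᵘ lhs                     ≡⟨ ℚ.fromℚᵘ-cong {lhs} {rhs} (ℚᵘ.*≡* numerators) ⟩
  ℚ.fromℚᵘ rhs                     ≡⟨ -/-≡ (+ (2 * q + 1)) (+ 1) 1 1 ⟨
  (+ (2 * q + 1) / 2) - ½          ∎
  where
  open ≡-Reasoning
  lhs = ℚᵘ.mkℚᵘ (+ (b + q)) 0 ℚᵘ.- ℚᵘ.mkℚᵘ (+ b) 0
  rhs = ℚᵘ.mkℚᵘ (+ (2 * q + 1)) 1 ℚᵘ.- ℚᵘ.mkℚᵘ (+ 1) 1
  -- Cross multiplication: the denominators are `1 * 1` on the left and `2 * 2` on the right.
  numerators : (+ (b + q) ℤ.* + 1 ℤ.+ ℤ.- (+ b) ℤ.* + 1) ℤ.* + 4 ≡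
               (+ (2 * q + 1) ℤ.* + 2 ℤ.+ ℤ.- (+ 1) ℤ.* + 2) ℤ.* + 1
  numerators = solve 2
    (λ b q → ((b :+ q) :* con (+ 1) :+ :- b :* con (+ 1)) :* con (+ 4) :=
             -- This is `2 * q + 1` with the product unfolded, as the goal computes to that form.
             ((q :+ (q :+ con (+ 0)) :+ con (+ 1)) :* con (+ 2) :+ :- con (+ 1) :* con (+ 2)) :* con (+ 1))
    refl (+ b) (+ q)
    where open ℤ-Solver.+-*-Solver

theorem2p9 : (q : ℕ) → 1 ≤ q →
    Σ[ T ∈ (ℕ → Graph) ]
    (∀ i j → i ≢ j → ¬ (T i ≅ T j)) ×
    (∀ i → IsTree (T i)
    × matchingNumber (T i) ≡ 2 * q + 1
    × (+ annihilationNumber (T i) / 1) - (+ independenceNumber (T i) / 1)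
    ≡ (+ matchingNumber (T i) / 2) - ½)
theorem2p9 q 1≤q = T , non-isomorphic , λ i →
    Spider.isTree (q + q) i
  , μ≡ i
  , difference≡half-minus-½ (independenceNumber (T i)) q
      (trans (annihilationNumber-spider q i 1≤q)
             (cong (_+ q) (sym (Spider.independenceNumber-spider (q + q) i))))
      (μ≡ i)
  where
  T : ℕ → Graph
  T = Spider.tree (q + q)
  μ≡ : ∀ i → matchingNumber (T i) ≡ 2 * q + 1
  μ≡ i = trans (Spider.matchingNumber-spider (q + q) i)
    (solve 1 (λ q → con 1 :+ (q :+ q) := con 2 :* q :+ con 1) refl q)
    where open +-*-Solver
  non-isomorphic : ∀ i j → i ≢ j → ¬ (T i ≅ T j)
  -- The order of `T i` is `suc ((q + q) + ((q + q) + suc i))`, which determines `i`.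
  non-isomorphic i j i≢j Ti≅Tj = i≢j (ℕ.suc-injective (ℕ.+-cancelˡ-≡ (q + q) _ _
    (ℕ.+-cancelˡ-≡ (q + q) _ _ (ℕ.suc-injective (≅⇒order≡ Ti≅Tj)))))
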